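{- Let $p\in\{1,2\}$ and let $G_2$ be the spider graph consisting of a center $v_0$ and three legs $v_0x_1x_2\cdots x_p$, $v_0y_1y_2\cdots y_p$, $v_0z_1z_2\cdots z_p$ (paths with $p$ vertices each besides $v_0$); write $x_0=y_0=z_0=v_0$. Let $H_1,\dots,H_{3p}$ be connected graphs, each with at least two vertices, with $m_i=|V(H_i)|$ ordered so that $m_1\le m_2\le\dots\le m_{3p}$. Let $\Gamma=G_2\diamond(H_1,\dots,H_{3p})$ be the generalized edge corona in which, for each $k\in\{0,1,\dots,p-1\}$, every vertex of $H_{3k+1}$ is joined to $x_{p-k}$ and $x_{p-k-1}$, every vertex of $H_{3k+2}$ is joined to $y_{p-k}$ and $y_{p-k-1}$, and every vertex of $H_{3k+3}$ is joined to $z_{p-k}$ and $z_{p-k-1}$. Then: (1) if $p=1$, $\Gamma$ is antimagic; (2) if $p=2$ and $\Delta(H_i)\le\delta(H_{i+1})$ for all $i\in\{1,\dots,5\}$, $d'(x_2)\le\delta'(H_2)$, $d'(y_2)\le\delta'(H_3)$ and $d'(z_2)\le\delta'(H_4)$, then $\Gamma$ is antimagic.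
   Context: All graphs are simple and undirected. A graph $G$ is antimagic if there is a bijection $f:E(G)\to\{1,2,\dots,|E(G)|\}$ such that the vertex sums $w(v)=\sum_{e\ni v}f(e)$ are pairwise distinct over all vertices $v$. For a graph $G$ with $m$ edges $e_1,\dots,e_m$ and graphs $H_1,\dots,H_m$, the generalized edge corona $G\diamond(H_1,\dots,H_m)$ is obtained from disjoint copies of $G,H_1,\dots,H_m$ by joining both end vertices of $e_i$ to every vertex of $H_i$, for each $i$. $\Delta(H)$ and $\delta(H)$ denote the maximum and minimum degree of $H$ itself. For a vertex $v$ of $\Gamma$, $d'(v)$ denotes its degree in $\Gamma$; $\delta'(H_i)$ denotes the minimum of $d'(v)$ over $v\in V(H_i)$ (so $d'(v)=\deg_{H_i}(v)+2$ for $v\in V(H_i)$). -}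

module Defs where

open import Algebra.Properties.CommutativeMonoid.Sum using (sum)
open import Data.Empty using (⊥-elim)
open import Data.Fin.Base
  using (Fin; zero; suc; toℕ; inject₁; opposite; combine; remQuot)
open import Data.Fin.Patterns using (0F; 1F; 2F)
open import Data.Fin.Properties
  using (inj⇒≟; toℕ-inject₁; opposite-involutive; combine-remQuot; 1↔⊤; 2↔Bool; +↔⊎; *↔×)
open import Data.Bool.Base using (Bool; true; false; if_then_else_)
open import Data.List.Base using (tabulate)
open import Data.List.Extrema.Nat using (max; min)
open import Data.Nat.Base using (ℕ; zero; suc; _+_; _*_)
open import Data.Nat.Properties using (+-0-commutativeMonoid; 1+n≢n; m≢1+n+m)
open import Data.Product.Base using (Σ; Σ-syntax; ∃-syntax; _×_; _,_; proj₁; proj₂; swap)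
open import Data.Product.Function.Dependent.Propositional using (Σ-↔)
open import Data.Product.Function.NonDependent.Propositional using (_×-↔_)
open import Data.Product.Properties using (,-injectiveˡ; ,-injectiveʳ)
open import Data.Sum.Base using (_⊎_; inj₁; inj₂)
open import Data.Sum.Function.Propositional using (_⊎-↔_)
open import Data.Sum.Properties using (inj₁-injective; inj₂-injective)
open import Data.Unit.Base using (⊤; tt)
open import Function.Base using (_∘_)
open import Function.Bundles using (_↔_; _⤖_; Inverse; Bijection; mk↔ₛ′)
open import Function.Definitions using (Injective)
open import Function.Properties.Inverse using (↔-refl; ↔-sym; ↔-trans; ↔⇒↣)
open import Relation.Binary.Construct.Closure.ReflexiveTransitive using (Star)
open import Relation.Binary.Definitions using (DecidableEquality)
open import Relation.Binary.PropositionalEquality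
  using (_≡_; _≢_; refl; sym; trans; cong)
open import Relation.Nullary using (Dec; does)
open import Relation.Nullary.Decidable using (_⊎-dec_)

sumℕ : ∀ {n} → (Fin n → ℕ) → ℕ
sumℕ = sum +-0-commutativeMonoid

record Finite (A : Set) : Set where
  field
    size  : ℕ
    index : A ↔ Fin size

  at : Fin size → A
  at = Inverse.from index

  _≟_ : DecidableEquality A
  _≟_ = inj⇒≟ (↔⇒↣ index)

  ∑ : (A → ℕ) → ℕ
  ∑ f = sumℕ (f ∘ at)

-- The maximum over the empty family is 0.
maximum : ∀ {n} → (Fin n → ℕ) → ℕ
maximum f = max 0 (tabulate f)

-- The minimum over the empty family is given the junk value 0; otherwise
-- this is the true minimum, the first argument of `min` being a member.
minimum : ∀ {n} → (Fin n → ℕ) → ℕ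
minimum {zero}  f = 0
minimum {suc n} f = min (f zero) (tabulate (f ∘ suc))

Fin-finite : ∀ n → Finite (Fin n)
Fin-finite n = record { size = n ; index = ↔-refl }

⊤-finite : Finite ⊤
⊤-finite = record { size = 1 ; index = ↔-sym 1↔⊤ }

Bool-finite : Finite Bool
Bool-finite = record { size = 2 ; index = ↔-sym 2↔Bool }

module _ {A B : Set} (FA : Finite A) (FB : Finite B) where
  private
    module A = Finite FA
    module B = Finite FB

  ⊎-finite : Finite (A ⊎ B)
  ⊎-finite = record
    { size  = A.size + B.size
    ; index = ↔-trans (A.index ⊎-↔ B.index) (↔-sym +↔⊎)
    }

  ×-finite : Finite (A × B)
  ×-finite = record
    { size  = A.size * B.size
    ; index = ↔-trans (A.index ×-↔ B.index) (↔-sym *↔×)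
    }

Σ-suc↔ : ∀ {n} {B : Fin (suc n) → Set} →
         Σ (Fin (suc n)) B ↔ (B zero ⊎ Σ (Fin n) (B ∘ suc))
Σ-suc↔ = mk↔ₛ′
  (λ { (zero , b) → inj₁ b ; (suc i , b) → inj₂ (i , b) })
  (λ { (inj₁ b) → zero , b ; (inj₂ (i , b)) → suc i , b })
  (λ { (inj₁ _) → refl ; (inj₂ _) → refl })
  (λ { (zero , _) → refl ; (suc _ , _) → refl })

Σ-Fin↔ : ∀ n {B : Fin n → Set} (FB : ∀ i → Finite (B i)) →
         Σ (Fin n) B ↔ Fin (sumℕ (Finite.size ∘ FB))
Σ-Fin↔ zero    FB = mk↔ₛ′ (λ ()) (λ ()) (λ ()) (λ ())
Σ-Fin↔ (suc n) FB =
  ↔-trans Σ-suc↔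
    (↔-trans (Finite.index (FB zero) ⊎-↔ Σ-Fin↔ n (FB ∘ suc)) (↔-sym +↔⊎))

Σ-finite : ∀ {A : Set} {B : A → Set} →
           Finite A → (∀ a → Finite (B a)) → Finite (Σ A B)
Σ-finite {A} {B} FA FB = record
  { size  = sumℕ (Finite.size ∘ FB ∘ at)
  ; index = ↔-trans (↔-sym (Σ-↔ (↔-sym index) ↔-refl)) (Σ-Fin↔ size (FB ∘ at))
  }
  where open Finite FA

-- The two ends of an edge are stored in an arbitrary order, which no
-- notion below depends on.
record Graph : Set₁ where
  field
    Vertex     : Set
    Edge       : Set
    ends       : Edge → Vertex × Vertex
    vertices   : Finite Vertex
    edges      : Finite Edge
    loopless   : ∀ e → proj₁ (ends e) ≢ proj₂ (ends e)
    noParallel : ∀ e e′ → ends e ≡ ends e′ ⊎ ends e ≡ swap (ends e′) → e ≡ e′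

  private
    module V = Finite vertices
    module E = Finite edges

  order : ℕ
  order = V.size

  ∣E∣ : ℕ
  ∣E∣ = E.size

  _∈ᵉ_ : Vertex → Edge → Set
  v ∈ᵉ e = v ≡ proj₁ (ends e) ⊎ v ≡ proj₂ (ends e)

  _∈ᵉ?_ : ∀ v e → Dec (v ∈ᵉ e)
  v ∈ᵉ? e = (v V.≟ proj₁ (ends e)) ⊎-dec (v V.≟ proj₂ (ends e))

  ∑-incident : (Edge → ℕ) → Vertex → ℕ
  ∑-incident f v = E.∑ λ e → if does (v ∈ᵉ? e) then f e else 0

  deg : Vertex → ℕ
  deg = ∑-incident (λ _ → 1)

  Δ : ℕ
  Δ = maximum (deg ∘ V.at)

  δ : ℕ
  δ = minimum (deg ∘ V.at)

  Adjacent : Vertex → Vertex → Set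
  Adjacent u v = ∃[ e ] (ends e ≡ (u , v) ⊎ ends e ≡ (v , u))

  Connected : Set
  Connected = ∀ u v → Star Adjacent u v

  -- `Fin ∣E∣` is {0,…,∣E∣-1}, so labels are shifted by one.
  label : Edge ⤖ Fin ∣E∣ → Edge → ℕ
  label f e = suc (toℕ (Bijection.to f e))

  Antimagic : Set
  Antimagic = Σ[ f ∈ Edge ⤖ Fin ∣E∣ ] Injective _≡_ _≡_ (∑-incident (label f))

module EdgeCorona (G : Graph) (H : Graph.Edge G → Graph) where
  private
    module G = Graph G
    module H e = Graph (H e)

  CVertex : Set
  CVertex = G.Vertex ⊎ (Σ[ e ∈ G.Edge ] H.Vertex e)

  pattern base v   = inj₁ v
  pattern copy e v = inj₂ (e , v)

  -- In `joinEdge e v b` the Boolean selects the end of e that v is joined to.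
  CEdge : Set
  CEdge = G.Edge ⊎ ((Σ[ e ∈ G.Edge ] H.Edge e) ⊎ (Σ[ e ∈ G.Edge ] H.Vertex e × Bool))

  pattern baseEdge e     = inj₁ e
  pattern copyEdge e d   = inj₂ (inj₁ (e , d))
  pattern joinEdge e v b = inj₂ (inj₂ (e , v , b))

  endOf : G.Edge → Bool → G.Vertex
  endOf e false = proj₁ (G.ends e)
  endOf e true  = proj₂ (G.ends e)

  cends : CEdge → CVertex × CVertex
  cends (baseEdge e)     = base (proj₁ (G.ends e)) , base (proj₂ (G.ends e))
  cends (copyEdge e d)   = copy e (proj₁ (H.ends e d)) , copy e (proj₂ (H.ends e d))
  cends (joinEdge e v b) = base (endOf e b) , copy e v

  private
    copy-injective : ∀ {e} {u v : H.Vertex e} →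
                     _≡_ {A = CVertex} (copy e u) (copy e v) → u ≡ v
    copy-injective refl = refl

    endOf-injective : ∀ e {b b′} → endOf e b ≡ endOf e b′ → b ≡ b′
    endOf-injective e {false} {false} _ = refl
    endOf-injective e {false} {true}  p = ⊥-elim (G.loopless e p)
    endOf-injective e {true}  {false} p = ⊥-elim (G.loopless e (sym p))
    endOf-injective e {true}  {true}  _ = refl

    pair : ∀ {A B : Set} {p q : A × B} → proj₁ p ≡ proj₁ q → proj₂ p ≡ proj₂ q → p ≡ q
    pair refl refl = refl

    tag : ∀ {e e′} {u : H.Vertex e} {v : H.Vertex e′} →
          _≡_ {A = CVertex} (copy e u) (copy e′ v) → e ≡ e′
    tag refl = refl

    cloopless : ∀ e → proj₁ (cends e) ≢ proj₂ (cends e)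
    cloopless (baseEdge e)   p = G.loopless e (inj₁-injective p)
    cloopless (copyEdge e d) p = H.loopless e d (copy-injective p)
    cloopless (joinEdge e v b) ()

    copies : ∀ {e e′} d d′ → e ≡ e′ →
             cends (copyEdge e d) ≡ cends (copyEdge e′ d′) ⊎
             cends (copyEdge e d) ≡ swap (cends (copyEdge e′ d′)) →
             _≡_ {A = CEdge} (copyEdge e d) (copyEdge e′ d′)
    copies {e} d d′ refl (inj₁ p) = cong (λ x → copyEdge e x)
      (H.noParallel e d d′ (inj₁ (pair (copy-injective (,-injectiveˡ p))
                                       (copy-injective (,-injectiveʳ p)))))
    copies {e} d d′ refl (inj₂ p) = cong (λ x → copyEdge e x)
      (H.noParallel e d d′ (inj₂ (pair (copy-injective (,-injectiveˡ p))
                                       (copy-injective (,-injectiveʳ p)))))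

    joins : ∀ {e e′} {v : H.Vertex e} {v′ : H.Vertex e′} {b b′} →
            _≡_ {A = CVertex} (copy e v) (copy e′ v′) → endOf e b ≡ endOf e′ b′ →
            _≡_ {A = CEdge} (joinEdge e v b) (joinEdge e′ v′ b′)
    joins {e} {v = v} refl q = cong (λ x → joinEdge e v x) (endOf-injective e q)

    cnoParallel : ∀ e e′ → cends e ≡ cends e′ ⊎ cends e ≡ swap (cends e′) → e ≡ e′
    cnoParallel (baseEdge e) (baseEdge e′) (inj₁ p) = cong inj₁
      (G.noParallel e e′ (inj₁ (pair (inj₁-injective (,-injectiveˡ p))
                                     (inj₁-injective (,-injectiveʳ p)))))
    cnoParallel (baseEdge e) (baseEdge e′) (inj₂ p) = cong inj₁
      (G.noParallel e e′ (inj₂ (pair (inj₁-injective (,-injectiveˡ p))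
                                     (inj₁-injective (,-injectiveʳ p)))))
    cnoParallel (baseEdge _) (copyEdge _ _)   (inj₁ ())
    cnoParallel (baseEdge _) (copyEdge _ _)   (inj₂ ())
    cnoParallel (baseEdge _) (joinEdge _ _ _) (inj₁ ())
    cnoParallel (baseEdge _) (joinEdge _ _ _) (inj₂ ())
    cnoParallel (copyEdge _ _) (baseEdge _) (inj₁ ())
    cnoParallel (copyEdge _ _) (baseEdge _) (inj₂ ())
    cnoParallel (copyEdge _ d) (copyEdge _ d′) (inj₁ p) =
      copies d d′ (tag (,-injectiveˡ p)) (inj₁ p)
    cnoParallel (copyEdge _ d) (copyEdge _ d′) (inj₂ p) =
      copies d d′ (tag (,-injectiveˡ p)) (inj₂ p)
    cnoParallel (copyEdge _ _) (joinEdge _ _ _) (inj₁ ())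
    cnoParallel (copyEdge _ _) (joinEdge _ _ _) (inj₂ ())
    cnoParallel (joinEdge _ _ _) (baseEdge _) (inj₁ ())
    cnoParallel (joinEdge _ _ _) (baseEdge _) (inj₂ ())
    cnoParallel (joinEdge _ _ _) (copyEdge _ _) (inj₁ ())
    cnoParallel (joinEdge _ _ _) (copyEdge _ _) (inj₂ ())
    cnoParallel (joinEdge _ _ _) (joinEdge _ _ _) (inj₁ p) =
      joins (,-injectiveʳ p) (inj₁-injective (,-injectiveˡ p))
    cnoParallel (joinEdge _ _ _) (joinEdge _ _ _) (inj₂ ())

  corona : Graph
  corona = record
    { Vertex     = CVertex
    ; Edge       = CEdge
    ; ends       = cends
    ; vertices   = ⊎-finite G.vertices (Σ-finite G.edges H.vertices)
    ; edges      = ⊎-finite G.edges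
                     (⊎-finite (Σ-finite G.edges H.edges)
                               (Σ-finite G.edges λ e → ×-finite (H.vertices e) Bool-finite))
    ; loopless   = cloopless
    ; noParallel = cnoParallel
    }

  d′ : CVertex → ℕ
  d′ = Graph.deg corona

  δ′ : G.Edge → ℕ
  δ′ e = minimum (λ i → d′ (copy e (Finite.at (H.vertices e) i)))

SpiderVertex : ℕ → Set
SpiderVertex p = ⊤ ⊎ (Fin 3 × Fin p)

-- `pos j s` is the s-th vertex of leg j, counted from the centre `pos j 0`.
pos : ∀ {p} → Fin 3 → Fin (suc p) → SpiderVertex p
pos j zero    = inj₁ tt
pos j (suc s) = inj₂ (j , s)

-- The edge (j , s) joins the s-th and the (s+1)-st vertex of leg j.
SpiderEdge : ℕ → Set
SpiderEdge p = Fin 3 × Fin p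

spiderEnds : ∀ {p} → SpiderEdge p → SpiderVertex p × SpiderVertex p
spiderEnds (j , s) = pos j (inject₁ s) , pos j (suc s)

private
  depth : ∀ {p} → SpiderVertex p → ℕ
  depth (inj₁ tt)      = 0
  depth (inj₂ (_ , s)) = suc (toℕ s)

  depth-lower : ∀ {p} j (s : Fin p) → depth (pos j (inject₁ s)) ≡ toℕ s
  depth-lower j zero    = refl
  depth-lower j (suc s) = cong suc (toℕ-inject₁ s)

  spider-loopless : ∀ {p} (e : SpiderEdge p) → proj₁ (spiderEnds e) ≢ proj₂ (spiderEnds e)
  spider-loopless (j , s) q =
    1+n≢n (sym (trans (sym (depth-lower j s)) (cong depth q)))

  spider-noParallel : ∀ {p} (e e′ : SpiderEdge p) →
    spiderEnds e ≡ spiderEnds e′ ⊎ spiderEnds e ≡ swap (spiderEnds e′) → e ≡ e′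
  spider-noParallel e e′ (inj₁ q) = inj₂-injective (,-injectiveʳ q)
  spider-noParallel (j , s) (j′ , s′) (inj₂ q) =
    ⊥-elim (m≢1+n+m (toℕ s) {1} (trans s≡1+s′ (cong suc (sym 1+s≡s′))))
    where
    s≡1+s′ : toℕ s ≡ suc (toℕ s′)
    s≡1+s′ = trans (sym (depth-lower j s)) (cong depth (,-injectiveˡ q))

    1+s≡s′ : suc (toℕ s) ≡ toℕ s′
    1+s≡s′ = trans (cong depth (,-injectiveʳ q)) (depth-lower j′ s′)

spider : ℕ → Graph
spider p = record
  { Vertex     = SpiderVertex p
  ; Edge       = SpiderEdge p
  ; ends       = spiderEnds
  ; vertices   = ⊎-finite ⊤-finite (×-finite (Fin-finite 3) (Fin-finite p))
  ; edges      = ×-finite (Fin-finite 3) (Fin-finite p)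
  ; loopless   = spider-loopless
  ; noParallel = spider-noParallel
  }

-- Indices are zero-based: `H i` with toℕ i = 3k + j is H_{3k+j+1}, which
-- is attached to the edge between the (p-k)-th and (p-k-1)-st vertices of leg j;
-- the lower position is p-k-1 = opposite k.
edgeOf : ∀ {p} → Fin (p * 3) → SpiderEdge p
edgeOf {p} i = let k , j = remQuot {p} 3 i in j , opposite k

indexOf : ∀ {p} → SpiderEdge p → Fin (p * 3)
indexOf (j , s) = combine (opposite s) j

indexOf-edgeOf : ∀ {p} (i : Fin (p * 3)) → indexOf {p} (edgeOf {p} i) ≡ i
indexOf-edgeOf {p} i = let k , j = remQuot {p} 3 i in
  trans (cong (λ l → combine l j) (opposite-involutive k)) (combine-remQuot {p} 3 i)

module Γ (p : ℕ) (H : Fin (p * 3) → Graph) where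
  open EdgeCorona (spider p) (λ e → H (indexOf {p} e)) public

  x y z : Fin (suc p) → CVertex
  x s = base (pos 0F s)
  y s = base (pos 1F s)
  z s = base (pos 2F s)

  δ′H : Fin (p * 3) → ℕ
  δ′H i = δ′ (edgeOf {p} i)

{-# OPTIONS --safe #-}
module Submission where

-- Order the edges in blocks and give later blocks larger labels. If the edges at u inject into
-- the edges at v so that each one is fixed or moved to a later block (and at least one moves),
-- then u has a smaller sum than v. Along the corona this yields, as a chain of classes,
--   H₁ < x₂ < H₂ < y₂ < H₃ < z₂ < (all neighbours of v₀) < v₀,
-- for p = 1 just its last two classes. The step from a leg's tip to the next copy uses
-- only the degree hypotheses, because all edges of the latter lie in later blocks.
-- The vertices of H₁, H₂, H₃ and the neighbours of v₀ each own one private edge, to x₂, y₂, z₂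
-- and v₀ respectively, and those of one class fill a whole block. Labelling that block in the
-- order of the partial sums over the remaining edges makes the sums within the class distinct.

open import Algebra.Properties.CommutativeMonoid.Sum using (sum-remove)
open import Algebra.Properties.Monoid.Sum using (sum-cong-≗)
open import Data.Bool.Base using (Bool; true; false; not; if_then_else_)
open import Data.Fin.Base
  using (Fin; zero; suc; toℕ; fromℕ<; combine; inject₁; punchIn; punchOut)
  renaming (_≤_ to _≤ᶠ_)
open import Data.Fin.Patterns using (0F; 1F; 2F; 3F; 4F)
open import Data.Fin.Properties as Fin
  using (any?; all?; ¬Fin0; toℕ<n; toℕ-fromℕ<; toℕ-injective; toℕ-combine; combine-injectiveˡ;
    combine-injectiveʳ; suc-injective; injective⇒≤; punchIn-injective; punchInᵢ≢i;
    punchIn-punchOut; punchOut-injective)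
open import Data.List.Base using (tabulate)
open import Data.List.Extrema.Nat using (min≤⊤; min≤xs; xs≤max)
open import Data.List.Relation.Unary.All.Properties using (tabulate⁻)
open import Data.Nat.Base using (ℕ; zero; suc; _+_; _*_; _≤_; _<_; z≤n; s≤s; s≤s⁻¹)
open import Data.Nat.Properties as ℕ
  using (≤-refl; ≤-reflexive; ≤-trans; <-trans; <-≤-trans; ≤-<-trans; <-irrefl; <-cmp; <⇒≤; <⇒≢;
    <⇒≱; n<1+n; 1+n≰n; m<n⇒m<1+n; m≤m+n; m≤n+m; m≤n⇒∃[o]m+o≡n; +-suc; +-identityʳ; +-cancelʳ-≡;
    +-mono-≤; +-mono-<-≤; +-mono-≤-<; +-monoʳ-<; +-0-monoid; +-0-commutativeMonoid)
open import Data.Product.Base using (Σ-syntax; ∃-syntax; _×_; _,_; proj₁; proj₂)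
open import Data.Product.Properties using (,-injectiveˡ)
open import Data.Product.Relation.Binary.Lex.Strict using (×-strictTotalOrder)
open import Data.Sum.Base using (_⊎_; inj₁; inj₂)
open import Data.Sum.Properties using (inj₁-injective; inj₂-injective)
open import Data.Unit.Base using (⊤; tt)
open import Function.Base using (_∘_)
open import Function.Bundles using (_⤖_; Bijection; Inverse; mk⇔; mk⤖)
open import Function.Definitions using (Injective; Surjective)
open import Level using (0ℓ)
open import Relation.Binary.Bundles using (StrictTotalOrder)
open import Relation.Binary.Definitions using (tri<; tri≈; tri>)
open import Relation.Binary.PropositionalEquality
  using (_≡_; _≢_; refl; sym; trans; cong; cong₂; subst; subst₂; module ≡-Reasoning)
open import Relation.Nullary using (Dec; yes; no; does; ¬_)
open import Relation.Nullary.Decidable using (dec-true; dec-false; does-⇔; from-yes)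
open import Relation.Nullary.Negation using (contradiction)
open import Relation.Unary using (Decidable)
open import Defs

-- Sums over index sets, compared along partial injections

sum-mono-≤ : ∀ {n} {g h : Fin n → ℕ} → (∀ i → g i ≤ h i) → sumℕ g ≤ sumℕ h
sum-mono-≤ {zero}  g≤h = z≤n
sum-mono-≤ {suc n} g≤h = +-mono-≤ (g≤h zero) (sum-mono-≤ (g≤h ∘ suc))

sum-mono-< : ∀ {n} {g h : Fin n → ℕ} → (∀ i → g i ≤ h i) → ∀ i → g i < h i → sumℕ g < sumℕ h
sum-mono-< g≤h zero    g<h = +-mono-<-≤ g<h (sum-mono-≤ (g≤h ∘ suc))
sum-mono-< g≤h (suc i) g<h = +-mono-≤-< (g≤h zero) (sum-mono-< (g≤h ∘ suc) i g<h)

sum-punchIn : ∀ {n} i (h : Fin (suc n) → ℕ) → sumℕ h ≡ h i + sumℕ (h ∘ punchIn i)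
sum-punchIn i h = sum-remove +-0-commutativeMonoid h

-- Here `g` is `h` with the entry at `i` erased. This will split the label of a private edge off a
-- vertex sum.
sum-clear : ∀ {n} i {h g : Fin n → ℕ} → g i ≡ 0 → (∀ j → j ≢ i → h j ≡ g j) →
            sumℕ h ≡ h i + sumℕ g
sum-clear {suc n} i {h} {g} gi≡0 h≡g = begin
  sumℕ h                          ≡⟨ sum-punchIn i h ⟩
  h i + sumℕ (h ∘ punchIn i)      ≡⟨ cong (h i +_) (sum-cong-≗ +-0-monoid agree) ⟩
  h i + sumℕ (g ∘ punchIn i)      ≡⟨ cong (λ x → h i + (x + sumℕ (g ∘ punchIn i))) gi≡0 ⟨
  h i + (g i + sumℕ (g ∘ punchIn i)) ≡⟨ cong (h i +_) (sum-punchIn i g) ⟨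
  h i + sumℕ g                    ∎
  where
  open ≡-Reasoning
  agree : ∀ j → h (punchIn i j) ≡ g (punchIn i j)
  agree j = h≡g (punchIn i j) (punchInᵢ≢i i j)

-- Unfolds to the summand of `∑-incident`, so facts about sums of `on` apply directly to vertex sums
-- and degrees.
on : {P : Set} → Dec P → ℕ → ℕ
on P? k = if does P? then k else 0

on-yes : {P : Set} (P? : Dec P) {k : ℕ} → P → on P? k ≡ k
on-yes P? p rewrite dec-true P? p = refl

on-no : {P : Set} (P? : Dec P) {k : ℕ} → ¬ P → on P? k ≡ 0
on-no P? ¬p rewrite dec-false P? ¬p = refl

on-cong : {P : Set} (P? : Dec P) {k l : ℕ} → (P → k ≡ l) → on P? k ≡ on P? l
on-cong (yes p) k≡l = k≡l p
on-cong (no _)  k≡l = refl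

on-mono : {P : Set} (P? : Dec P) {k l : ℕ} → (P → k ≤ l) → on P? k ≤ on P? l
on-mono (yes p) k≤l = k≤l p
on-mono (no _)  k≤l = z≤n

on-mono-⇒ : {P Q : Set} (P? : Dec P) (Q? : Dec Q) {k : ℕ} → (P → Q) → on P? k ≤ on Q? k
on-mono-⇒ (no _)  Q? P⇒Q = z≤n
on-mono-⇒ (yes p) Q? P⇒Q = ≤-reflexive (sym (on-yes Q? (P⇒Q p)))

-- The image may depend on the proof of `P a`, so an edge map can be defined by cases on how the
-- edge meets the vertex, without proof irrelevance of incidence.
record PartialInjection {A B : Set} (P : A → Set) (Q : B → Set) : Set where
  field
    to        : ∀ a → P a → B
    to-Q      : ∀ a p → Q (to a p)
    injective : ∀ {a a′} p p′ → to a p ≡ to a′ p′ → a ≡ a′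

-- Induction on the domain: when the first index satisfies `P`, its image `k` is punched out of the
-- codomain, and the remaining indices still inject into what is left.
sum-inject-≤ : ∀ {n m} {P : Fin n → Set} {Q : Fin m → Set} (P? : Decidable P) (φ : PartialInjection P Q)
               {g : Fin n → ℕ} {h : Fin m → ℕ} →
               (∀ i p → g i ≤ h (PartialInjection.to φ i p)) → sumℕ (λ i → on (P? i) (g i)) ≤ sumℕ h
sum-inject-≤ {zero} P? φ g≤h = z≤n
sum-inject-≤ {suc n} {m} {P} {Q} P? φ {g} {h} g≤h with P? zero
... | no _ = sum-inject-≤ {Q = Q} (P? ∘ suc)
       (record { to = λ i → to (suc i) ; to-Q = λ i → to-Q (suc i)
               ; injective = λ p p′ → suc-injective ∘ injective p p′ })
       (λ i → g≤h (suc i))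
  where open PartialInjection φ
sum-inject-≤ {suc n} {zero} P? φ g≤h | yes p₀ = contradiction (PartialInjection.to φ zero p₀) ¬Fin0
sum-inject-≤ {suc n} {suc m} {P} {Q} P? φ {g} {h} g≤h | yes p₀ =
  ≤-trans (+-mono-≤ (g≤h zero p₀) rest) (≤-reflexive (sym (sum-punchIn k h)))
  where
  open PartialInjection φ
  k = to zero p₀

  k≢ : ∀ i p → k ≢ to (suc i) p
  k≢ i p eq with () ← injective p₀ p eq

  rest = sum-inject-≤ {Q = λ _ → ⊤} (P? ∘ suc)
    (record { to = λ i p → punchOut (k≢ i p) ; to-Q = λ _ _ → tt
            ; injective = λ {a} {a′} p p′ →
                suc-injective ∘ injective p p′ ∘ punchOut-injective (k≢ a p) (k≢ a′ p′) })
    (λ i p → subst (λ j → g (suc i) ≤ h j) (sym (punchIn-punchOut (k≢ i p))) (g≤h (suc i) p))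

sum-positive : ∀ {m} {Q : Fin m → Set} (Q? : Decidable Q) →
               0 < sumℕ (λ j → on (Q? j) 1) → ∃[ j ] Q j
sum-positive {suc m} Q? pos with Q? zero
... | yes q = zero , q
... | no _  = let j , q = sum-positive (Q? ∘ suc) pos in suc j , q

-- Greedy matching: a first index in `P` forces the count of `Q` to be positive, so some `k` in `Q`
-- is free for it; removing `k` lowers both counts by one.
count-≤⇒inject : ∀ {n m} {P : Fin n → Set} {Q : Fin m → Set} (P? : Decidable P) (Q? : Decidable Q) →
                 sumℕ (λ i → on (P? i) 1) ≤ sumℕ (λ j → on (Q? j) 1) → PartialInjection P Q
count-≤⇒inject {zero} P? Q? le = record { to = λ () ; to-Q = λ () ; injective = λ {} }
count-≤⇒inject {suc n} {m} {P} {Q} P? Q? le with P? zero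
... | no ¬p₀ = record { to = to′ ; to-Q = to-Q′ ; injective = injective′ }
  where
  open PartialInjection (count-≤⇒inject (P? ∘ suc) Q? le)
  to′ : ∀ i → P i → Fin m
  to′ zero    p = contradiction p ¬p₀
  to′ (suc i) p = to i p

  to-Q′ : ∀ i p → Q (to′ i p)
  to-Q′ zero    p = contradiction p ¬p₀
  to-Q′ (suc i) p = to-Q i p

  injective′ : ∀ {i i′} p p′ → to′ i p ≡ to′ i′ p′ → i ≡ i′
  injective′ {zero}           p p′ _  = contradiction p ¬p₀
  injective′ {suc i} {zero}   p p′ _  = contradiction p′ ¬p₀
  injective′ {suc i} {suc i′} p p′ eq = cong suc (injective p p′ eq)
... | yes p₀ with sum-positive Q? (≤-trans (s≤s z≤n) le)
count-≤⇒inject {suc n} {suc m} {P} {Q} P? Q? le | yes p₀ | k , q =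
  record { to = to′ ; to-Q = to-Q′ ; injective = injective′ }
  where
  count-k : sumℕ (λ j → on (Q? j) 1) ≡ 1 + sumℕ (λ j → on (Q? (punchIn k j)) 1)
  count-k = trans (sum-punchIn k (λ j → on (Q? j) 1)) 
    (cong (_+ sumℕ (λ j → on (Q? (punchIn k j)) 1)) (on-yes (Q? k) q))

  open PartialInjection
    (count-≤⇒inject (P? ∘ suc) (Q? ∘ punchIn k) (s≤s⁻¹ (≤-trans le (≤-reflexive count-k))))
  to′ : ∀ i → P i → Fin (suc m)
  to′ zero    p = k
  to′ (suc i) p = punchIn k (to i p)

  to-Q′ : ∀ i p → Q (to′ i p)
  to-Q′ zero    p = q
  to-Q′ (suc i) p = to-Q i p

  injective′ : ∀ {i i′} p p′ → to′ i p ≡ to′ i′ p′ → i ≡ i′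
  injective′ {zero}  {zero}   p p′ _  = refl
  injective′ {zero}  {suc i′} p p′ eq = contradiction (sym eq) (punchInᵢ≢i k (to i′ p′))
  injective′ {suc i} {zero}   p p′ eq = contradiction eq (punchInᵢ≢i k (to i p))
  injective′ {suc i} {suc i′} p p′ eq = cong suc (injective p p′ (punchIn-injective k _ _ eq))

-- Pigeonhole: punching out a missed value would inject `Fin (suc n)` into `Fin n`.
injective⇒surjective : ∀ {n} {f : Fin n → Fin n} → Injective _≡_ _≡_ f → Surjective _≡_ _≡_ f
injective⇒surjective {suc n} {f} inj y with any? (λ x → f x Fin.≟ y)
... | yes (x , fx≡y) = x , λ { refl → fx≡y }
... | no  y∉f = contradiction (injective⇒≤ λ {x} {x′} → inj ∘ punchOut-injective (y≢f x) (y≢f x′)) 1+n≰n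
  where
  y≢f : ∀ x → y ≢ f x
  y≢f x y≡fx = y∉f (x , sym y≡fx)

-- The same tools for sums over finite types

module FiniteProperties {A : Set} (FA : Finite A) where
  open Finite FA

  at-index : ∀ a → at (Inverse.to index a) ≡ a
  at-index a = Inverse.strictlyInverseʳ index a

  index-at : ∀ i → Inverse.to index (at i) ≡ i
  index-at i = Inverse.strictlyInverseˡ index i

  index-injective : ∀ {a b} → Inverse.to index a ≡ Inverse.to index b → a ≡ b
  index-injective {a} {b} eq = trans (sym (at-index a)) (trans (cong at eq) (at-index b))

  at-injective : ∀ {i j} → at i ≡ at j → i ≡ j
  at-injective {i} {j} eq = trans (sym (index-at i)) (trans (cong (Inverse.to index) eq) (index-at j))

  ∑-cong : ∀ {g h : A → ℕ} → (∀ a → g a ≡ h a) → ∑ g ≡ ∑ h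
  ∑-cong g≡h = sum-cong-≗ +-0-monoid (g≡h ∘ at)

  ∑-mono-< : ∀ {g h : A → ℕ} → (∀ a → g a ≤ h a) → ∀ a → g a < h a → ∑ g < ∑ h
  ∑-mono-< {g} {h} g≤h a g<h = sum-mono-< (g≤h ∘ at) (Inverse.to index a)
    (subst (λ b → g b < h b) (sym (at-index a)) g<h)

  ∑-clear : ∀ a {h g : A → ℕ} → g a ≡ 0 → (∀ b → b ≢ a → h b ≡ g b) → ∑ h ≡ h a + ∑ g
  ∑-clear a {h} {g} ga≡0 h≡g = trans
    (sum-clear (Inverse.to index a) (trans (cong g (at-index a)) ga≡0)
       λ j j≢ → h≡g (at j) λ eq → j≢ (trans (sym (index-at j)) (cong (Inverse.to index) eq)))
    (cong (λ b → h b + ∑ g) (at-index a))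

  ∑-1 : ∑ (λ _ → 1) ≡ size
  ∑-1 = lemma size
    where
    lemma : ∀ n → sumℕ {n} (λ _ → 1) ≡ n
    lemma zero    = refl
    lemma (suc n) = cong suc (lemma n)

  injective⇒⤖ : (f : A → Fin size) → Injective _≡_ _≡_ f → A ⤖ Fin size
  injective⇒⤖ f inj = mk⤖ {to = f} (inj , λ y →
    let i , eq = injective⇒surjective (λ {i} {j} → at-injective ∘ inj {at i} {at j}) y
    in at i , λ { refl → eq refl })

module _ {A B : Set} (FA : Finite A) (FB : Finite B) where
  private
    module A = Finite FA
    module B = Finite FB
    module AP = FiniteProperties FA
    module BP = FiniteProperties FB

  ∑-inject-≤ : ∀ {P : A → Set} {Q : B → Set} (P? : Decidable P) (Q? : Decidable Q)
               (φ : PartialInjection P Q)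
               {g : A → ℕ} {h : B → ℕ} → (∀ a p → g a ≤ h (PartialInjection.to φ a p)) →
               A.∑ (λ a → on (P? a) (g a)) ≤ B.∑ (λ b → on (Q? b) (h b))
  ∑-inject-≤ {P} {Q} P? Q? φ {g} {h} g≤h = sum-inject-≤ {Q = λ _ → ⊤} (P? ∘ A.at)
    (record { to = λ i p → Inverse.to B.index (to (A.at i) p)
            ; to-Q = λ _ _ → tt
            ; injective = λ p p′ → AP.at-injective ∘ injective p p′ ∘ BP.index-injective })
    (λ i p → subst (λ b → g (A.at i) ≤ on (Q? b) (h b)) (sym (BP.at-index (to (A.at i) p)))
       (≤-trans (g≤h (A.at i) p) (≤-reflexive (sym (on-yes (Q? _) (to-Q (A.at i) p))))))
    where open PartialInjection φ

  ∑-inject-< : ∀ {P : A → Set} {Q : B → Set} (P? : Decidable P) (Q? : Decidable Q)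
               (φ : PartialInjection P Q)
               {g : A → ℕ} {h : B → ℕ} → (∀ a p → g a ≤ h (PartialInjection.to φ a p)) →
               ∀ a → P a → (∀ p → g a < h (PartialInjection.to φ a p)) →
               A.∑ (λ a → on (P? a) (g a)) < B.∑ (λ b → on (Q? b) (h b))
  ∑-inject-< {P} {Q} P? Q? φ {g} {h} g≤h a₀ p₀ g<h =
    <-≤-trans (AP.∑-mono-< (λ a → on-mono (P? a) λ _ → g≤g⁺ a) a₀ strict)
              (∑-inject-≤ P? Q? φ {h = h} g⁺≤h)
    where
    open PartialInjection φ
    -- Raising `g` by one at `a₀` alone is still dominated by `h` along the injection, thanks to
    -- `g<h`, so strictness reduces to the weak inequality.
    g⁺ : A → ℕ
    g⁺ a = on (a A.≟ a₀) 1 + g a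

    g≤g⁺ : ∀ a → g a ≤ g⁺ a
    g≤g⁺ a = m≤n+m (g a) (on (a A.≟ a₀) 1)

    g⁺≤h : ∀ a p → g⁺ a ≤ h (to a p)
    g⁺≤h a p with a A.≟ a₀
    ... | yes refl = subst (λ k → k + g a ≤ h (to a p)) (sym (on-yes (a A.≟ a) refl)) (g<h p)
    ... | no a≢a₀  = subst (λ k → k + g a ≤ h (to a p)) (sym (on-no (a A.≟ a₀) a≢a₀)) (g≤h a p)

    strict : on (P? a₀) (g a₀) < on (P? a₀) (g⁺ a₀)
    strict rewrite dec-true (P? a₀) p₀ | on-yes (a₀ A.≟ a₀) {1} refl = n<1+n (g a₀)

  ∑-≤⇒inject : ∀ {P : A → Set} {Q : B → Set} (P? : Decidable P) (Q? : Decidable Q) →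
               A.∑ (λ a → on (P? a) 1) ≤ B.∑ (λ b → on (Q? b) 1) → PartialInjection P Q
  ∑-≤⇒inject {P} {Q} P? Q? le = record
    { to        = λ a p → B.at (to (Inverse.to A.index a) (P-at p))
    ; to-Q      = λ a p → to-Q (Inverse.to A.index a) (P-at p)
    ; injective = λ p p′ → AP.index-injective ∘ injective (P-at p) (P-at p′) ∘ BP.at-injective
    }
    where
    open PartialInjection (count-≤⇒inject (P? ∘ A.at) (Q? ∘ B.at) le)
    P-at : ∀ {a} → P a → P (A.at (Inverse.to A.index a))
    P-at {a} = subst P (sym (AP.at-index a))

  size-≤⇒inject : A.size ≤ B.size → Σ[ f ∈ (A → B) ] Injective _≡_ _≡_ f
  size-≤⇒inject le = (λ a → to a tt) , injective tt tt
    where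
    open PartialInjection (∑-≤⇒inject (λ _ → yes tt) (λ _ → yes tt)
      (≤-trans (≤-reflexive AP.∑-1) (≤-trans le (≤-reflexive (sym BP.∑-1)))))

-- Numbering a finite type along a lexicographic order

module LexRank {A : Set} (FA : Finite A) (b s : A → ℕ) where
  open Finite FA
  open FiniteProperties FA
  private
    O : StrictTotalOrder 0ℓ 0ℓ 0ℓ
    O = ×-strictTotalOrder ℕ.<-strictTotalOrder
          (×-strictTotalOrder ℕ.<-strictTotalOrder (Fin.<-strictTotalOrder size))
    module O = StrictTotalOrder O

  -- The block `b` decides first and `s` orders the inside of a block; the index only breaks ties,
  -- which makes the order total and the rank injective.
  key : A → O.Carrier
  key a = b a , s a , Inverse.to index a

  infix 4 _≺_ _≺?_

  _≺_ : A → A → Set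
  a ≺ a′ = key a O.< key a′

  _≺?_ : ∀ a a′ → Dec (a ≺ a′)
  a ≺? a′ = key a O.<? key a′

  opaque
    rank : A → ℕ
    rank a = ∑ λ a′ → on (a′ ≺? a) 1

    rank≡∑ : ∀ a → rank a ≡ ∑ λ a′ → on (a′ ≺? a) 1
    rank≡∑ a = refl

  ≺-irrefl : ∀ {a} → ¬ a ≺ a
  ≺-irrefl {a} = O.irrefl {key a} O.Eq.refl

  -- By transitivity the predecessors of `a` are among those of `a′`, and `a` itself is one more.
  rank-mono-< : ∀ {a a′} → a ≺ a′ → rank a < rank a′
  rank-mono-< {a} {a′} a≺a′ = subst₂ _<_ (sym (rank≡∑ a)) (sym (rank≡∑ a′)) (∑-mono-<
    (λ d → on-mono-⇒ (d ≺? a) (d ≺? a′) (λ d≺a → O.trans {key d} {key a} {key a′} d≺a a≺a′))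
    a
    (subst₂ _<_ (sym (on-no (a ≺? a) (≺-irrefl {a}))) (sym (on-yes (a ≺? a′) a≺a′)) (n<1+n 0)))

  rank-bounded : ∀ a → rank a < size
  rank-bounded a = subst₂ _<_ (sym (rank≡∑ a)) ∑-1
    (∑-mono-< (λ d → on-mono-⇒ (d ≺? a) (yes tt) (λ _ → tt)) a
      (subst (_< 1) (sym (on-no (a ≺? a) (≺-irrefl {a}))) (n<1+n 0)))

  rank-injective : ∀ {a a′} → rank a ≡ rank a′ → a ≡ a′
  rank-injective {a} {a′} eq with O.compare (key a) (key a′)
  ... | tri< lt _ _ = contradiction eq (<⇒≢ (rank-mono-< {a} {a′} lt))
  ... | tri≈ _ e _  = index-injective (proj₂ (proj₂ e))
  ... | tri> _ _ gt = contradiction (sym eq) (<⇒≢ (rank-mono-< {a′} {a} gt))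

  opaque
    bijection : A ⤖ Fin size
    bijection = injective⇒⤖ (λ a → fromℕ< (rank-bounded a))
      λ {a} {a′} eq → rank-injective
        (trans (sym (toℕ-fromℕ< (rank-bounded a))) (trans (cong toℕ eq) (toℕ-fromℕ< (rank-bounded a′))))

    toℕ-bijection : ∀ a → toℕ (Bijection.to bijection a) ≡ rank a
    toℕ-bijection a = toℕ-fromℕ< (rank-bounded a)

-- A criterion for antimagic labellings by blocks and private edges

module Criterion (G : Graph) (b : Graph.Edge G → ℕ) (isPrivate : ℕ → Bool) where
  open Graph G
  private
    module E = Finite edges
    module EP = FiniteProperties edges

  Monotone : (Edge → ℕ) → Set
  Monotone f = ∀ {e e′} → b e < b e′ → f e < f e′

  infix 4 _⊏_

  -- Quantifying over all monotone `f` makes the relation depend on the blocks alone, so it can be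
  -- proved before the order inside the blocks is chosen.
  record _⊏_ (u v : Vertex) : Set where
    constructor mk⊏
    field
      ∑-< : ∀ {f} → Monotone f → ∑-incident f u < ∑-incident f v

  -- Meaningful on private edges only; in the corona of the spider it is the copy vertex of
  -- a joining edge and the end further from the centre of a base edge.
  owner : Edge → Vertex
  owner e = proj₂ (ends e)

  -- `only` leaves one private summand in the sum at `u`; `owned` recovers `u` from that edge.
  record Private (u : Vertex) (e : Edge) : Set where
    field
      owned         : u ≡ owner e
      private-block : isPrivate (b e) ≡ true
      only          : ∀ e′ → u ∈ᵉ e′ → e′ ≢ e → isPrivate (b e′) ≡ false

  private
    -- f₀ and f₁ differ only by reorderings inside private blocks, so partial sums over
    -- the other edges may be taken with f₀ before f₁ is known.
    module R₀ = LexRank edges b (λ _ → 0)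

    f₀ : Edge → ℕ
    f₀ = label R₀.bijection

    public-label : Edge → ℕ
    public-label e = if isPrivate (b e) then 0 else f₀ e

    -- The value 0 on public edges leaves the ties in public blocks to the index, exactly as in
    -- `R₀`.
    partial-sum : Edge → ℕ
    partial-sum e = if isPrivate (b e) then ∑-incident public-label (owner e) else 0

    module R₁ = LexRank edges b partial-sum

    f₁ : Edge → ℕ
    f₁ = label R₁.bijection

    f₁-mono : ∀ {e e′} → e R₁.≺ e′ → f₁ e < f₁ e′
    f₁-mono {e} {e′} lt = s≤s (subst₂ _<_ (sym (R₁.toℕ-bijection e)) (sym (R₁.toℕ-bijection e′))
                                 (R₁.rank-mono-< {e} {e′} lt))

    f₁-injective : ∀ {e e′} → f₁ e ≡ f₁ e′ → e ≡ e′
    f₁-injective {e} {e′} eq = R₁.rank-injective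
      (trans (sym (R₁.toℕ-bijection e)) (trans (ℕ.suc-injective eq) (R₁.toℕ-bijection e′)))

    -- A public edge has the same predecessors in both orders: those in earlier blocks agree, and
    -- those in its own block are public too, hence compared by index in both.
    f₁≡f₀ : ∀ e → isPrivate (b e) ≡ false → f₁ e ≡ f₀ e
    f₁≡f₀ e pub = cong suc (begin
      toℕ (Bijection.to R₁.bijection e) ≡⟨ R₁.toℕ-bijection e ⟩
      R₁.rank e                         ≡⟨ R₁.rank≡∑ e ⟩
      E.∑ (λ d → on (d R₁.≺? e) 1)      ≡⟨ EP.∑-cong same-predecessors ⟩
      E.∑ (λ d → on (d R₀.≺? e) 1)      ≡⟨ R₀.rank≡∑ e ⟨
      R₀.rank e                         ≡⟨ R₀.toℕ-bijection e ⟨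
      toℕ (Bijection.to R₀.bijection e) ∎)
      where
      open ≡-Reasoning
      s≡0 : ∀ d → b d ≡ b e → partial-sum d ≡ 0
      s≡0 d eq rewrite eq | pub = refl

      to : ∀ d → d R₁.≺ e → d R₀.≺ e
      to d (inj₁ lt) = inj₁ lt
      to d (inj₂ (eq , inj₁ lt)) with () ← subst (partial-sum d <_) (s≡0 e refl) lt
      to d (inj₂ (eq , inj₂ (_ , lt))) = inj₂ (eq , inj₂ (refl , lt))

      from : ∀ d → d R₀.≺ e → d R₁.≺ e
      from d (inj₁ lt) = inj₁ lt
      from d (inj₂ (eq , inj₂ (_ , lt))) = inj₂ (eq , inj₂ (trans (s≡0 d eq) (sym (s≡0 e refl)) , lt))

      same-predecessors : ∀ d → on (d R₁.≺? e) 1 ≡ on (d R₀.≺? e) 1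
      same-predecessors d = cong (λ t → if t then 1 else 0)
        (does-⇔ (mk⇔ (to d) (from d)) (d R₁.≺? e) (d R₀.≺? e))

    -- Every other edge at `u` is public and keeps its label from `f₀`, so it contributes the same
    -- to both sums, while the private edge counts 0 in `public-label`.
    ∑-private : ∀ {u e} → Private u e → ∑-incident f₁ u ≡ f₁ e + ∑-incident public-label u
    ∑-private {u} {e} P = trans
      (EP.∑-clear e cleared agree)
      (cong (_+ ∑-incident public-label u) (on-yes (u ∈ᵉ? e) (inj₂ owned)))
      where
      open Private P
      cleared : on (u ∈ᵉ? e) (public-label e) ≡ 0
      cleared = trans (on-yes (u ∈ᵉ? e) (inj₂ owned)) (cong (λ t → if t then 0 else f₀ e) private-block)

      agree : ∀ d → d ≢ e → on (u ∈ᵉ? d) (f₁ d) ≡ on (u ∈ᵉ? d) (public-label d)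
      agree d d≢e = on-cong (u ∈ᵉ? d) λ i →
        trans (f₁≡f₀ d (only d i d≢e)) (cong (λ t → if t then 0 else f₀ d) (sym (only d i d≢e)))

    partial-sum-private : ∀ {u e} → Private u e → partial-sum e ≡ ∑-incident public-label u
    partial-sum-private {u} {e} P = begin
      partial-sum e                       ≡⟨ cong (if_then w else 0) (Private.private-block P) ⟩
      ∑-incident public-label (owner e)   ≡⟨ cong (∑-incident public-label) (Private.owned P) ⟨
      ∑-incident public-label u           ∎
      where
      open ≡-Reasoning
      w = ∑-incident public-label (owner e)

    -- Inside a block `R₁` orders private edges by the partial sums of their owners, so the private
    -- label and the remaining sum increase together.
    private-< : ∀ {u v e e′} → Private u e → Private v e′ → b e ≡ b e′ →
                ∑-incident public-label u < ∑-incident public-label v → ∑-incident f₁ u < ∑-incident f₁ v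
    private-< {e = e} {e′} P Q eq lt = subst₂ _<_ (sym (∑-private P)) (sym (∑-private Q))
      (+-mono-<-≤ (f₁-mono {e} {e′} (inj₂ (eq , inj₁ lt′))) (<⇒≤ lt))
      where
      lt′ : partial-sum e < partial-sum e′
      lt′ = subst₂ _<_ (sym (partial-sum-private P)) (sym (partial-sum-private Q)) lt

    private-≢ : ∀ {u v e e′} → Private u e → Private v e′ → b e ≡ b e′ →
                ∑-incident f₁ u ≡ ∑-incident f₁ v → u ≡ v
    private-≢ {u} {v} {e} {e′} P Q eq w≡
      with <-cmp (∑-incident public-label u) (∑-incident public-label v)
    ... | tri< lt _ _ = contradiction w≡ (<⇒≢ (private-< P Q eq lt))
    ... | tri> _ _ gt = contradiction (sym w≡) (<⇒≢ (private-< Q P (sym eq) gt))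
    -- Equal partial sums cancel, leaving equal private labels; these belong to one edge, which has
    -- one owner.
    ... | tri≈ _ s≡ _ =
      trans (Private.owned P) (trans (cong owner (f₁-injective f₁≡)) (sym (Private.owned Q)))
      where
      f₁≡ : f₁ e ≡ f₁ e′
      f₁≡ = +-cancelʳ-≡ (∑-incident public-label u) (f₁ e) (f₁ e′)
        (trans (sym (∑-private P)) (trans w≡ (trans (∑-private Q) (cong (f₁ e′ +_) (sym s≡)))))

  -- `block` assigns to a class the block that holds its private edges, so two members of a class
  -- always compare their private edges within a single block.
  antimagic : (c : Vertex → ℕ) (block : ℕ → ℕ) →
              (∀ {u v} → c u < c v → u ⊏ v) →
              (∀ u → (∃[ e ] Private u e × b e ≡ block (c u)) ⊎ (∀ v → c u ≡ c v → u ≡ v)) →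
              Antimagic
  antimagic c block increasing separated = R₁.bijection , distinct
    where
    f₁-monotone : Monotone f₁
    f₁-monotone {e} {e′} lt = f₁-mono {e} {e′} (inj₁ lt)

    distinct : ∀ {u v} → ∑-incident f₁ u ≡ ∑-incident f₁ v → u ≡ v
    distinct {u} {v} w≡ with <-cmp (c u) (c v)
    ... | tri< lt _ _ = contradiction w≡ (<⇒≢ (_⊏_.∑-< (increasing {u} {v} lt) f₁-monotone))
    ... | tri> _ _ gt = contradiction (sym w≡) (<⇒≢ (_⊏_.∑-< (increasing {v} {u} gt) f₁-monotone))
    ... | tri≈ _ c≡ _ with separated u | separated v
    ...   | inj₂ only-u | _           = only-u v c≡
    ...   | inj₁ _      | inj₂ only-v = sym (only-v u (sym c≡))
    ...   | inj₁ (e , P , b≡) | inj₁ (e′ , Q , b′≡) =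
      private-≢ P Q (trans b≡ (trans (cong block c≡) (sym b′≡))) w≡

  ⊏-trans : ∀ {u v w} → u ⊏ v → v ⊏ w → u ⊏ w
  ⊏-trans (mk⊏ u<v) (mk⊏ v<w) = mk⊏ λ mono → <-trans (u<v mono) (v<w mono)

  -- Induction on the gap `d` between the classes. Composing single steps requires an actual vertex
  -- in the next class, which `dense` provides.
  ⊏-chain : (c : Vertex → ℕ) →
            (∀ {u v} → c v ≡ suc (c u) → u ⊏ v) →
            (∀ {u v} → suc (c u) < c v → ∃[ w ] c w ≡ suc (c u)) →
            ∀ {u v} → c u < c v → u ⊏ v
  ⊏-chain c step dense {u} {v} c< =
    let d , eq = m≤n⇒∃[o]m+o≡n c< in go d (sym eq)
    where
    go : ∀ d {u v} → c v ≡ suc (c u) + d → u ⊏ v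
    go zero    {u} eq = step (trans eq (+-identityʳ (suc (c u))))
    go (suc d) {u} {v} eq =
      let eq′ = trans eq (+-suc (suc (c u)) d)
          w , cw = dense {u} {v} (subst (suc (c u) <_) (sym eq′) (s≤s (m≤m+n (suc (c u)) d)))
      in ⊏-trans (step cw) (go d (trans eq′ (cong (λ k → suc (k + d)) (sym cw))))

  record Raises (u v : Vertex) : Set where
    field
      φ      : PartialInjection (u ∈ᵉ_) (v ∈ᵉ_)
    open PartialInjection φ public
    field
      raises : ∀ e i → to e i ≡ e ⊎ b e < b (to e i)
      strict : ∃[ e ] u ∈ᵉ e × (∀ i → b e < b (to e i))

  raises⇒⊏ : ∀ {u v} → Raises u v → u ⊏ v
  raises⇒⊏ {u} {v} r = mk⊏ λ {f} mono →
    ∑-inject-< edges edges (u ∈ᵉ?_) (v ∈ᵉ?_) φ {h = f}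
      (λ e i → le mono (raises e i))
      (proj₁ strict) (proj₁ (proj₂ strict)) (λ i → mono (proj₂ (proj₂ strict) i))
    where
    open Raises r
    le : ∀ {f e e′} → Monotone f → e′ ≡ e ⊎ b e < b e′ → f e ≤ f e′
    le _    (inj₁ refl) = ≤-refl
    le mono (inj₂ lt)   = <⇒≤ (mono lt)

  -- The degree inequality yields some injection between the incident edges. Nothing need be known
  -- about it, since every edge at `v` lies in a later block than every edge at `u`.
  deg-≤⇒⊏ : ∀ {u v} → deg u ≤ deg v → (∃[ e ] u ∈ᵉ e) →
            (∀ {e e′} → u ∈ᵉ e → v ∈ᵉ e′ → b e < b e′) → u ⊏ v
  deg-≤⇒⊏ {u} {v} d≤ (e₀ , i₀) b< = raises⇒⊏ record
    { φ      = φ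
    ; raises = λ e i → inj₂ (b< i (PartialInjection.to-Q φ e i))
    ; strict = e₀ , i₀ , λ i → b< i (PartialInjection.to-Q φ e₀ i)
    }
    where
    φ : PartialInjection (u ∈ᵉ_) (v ∈ᵉ_)
    φ = ∑-≤⇒inject edges edges (u ∈ᵉ?_) (v ∈ᵉ?_) d≤

-- Bounds by extrema, and restriction of partial injections

minimum-≤ : ∀ {n} (f : Fin n → ℕ) i → minimum f ≤ f i
minimum-≤ f zero    = min≤⊤ (f zero) (tabulate (f ∘ suc))
minimum-≤ f (suc i) = tabulate⁻ (min≤xs (f zero) (tabulate (f ∘ suc))) i

≤-maximum : ∀ {n} (f : Fin n → ℕ) i → f i ≤ maximum f
≤-maximum f = tabulate⁻ (xs≤max 0 (tabulate f))

module _ {A : Set} (FA : Finite A) where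
  open Finite FA
  open FiniteProperties FA

  minimum-at-≤ : (f : A → ℕ) → ∀ a → minimum (f ∘ at) ≤ f a
  minimum-at-≤ f a =
    subst (λ d → minimum (f ∘ at) ≤ f d) (at-index a) (minimum-≤ (f ∘ at) (Inverse.to index a))

  ≤-maximum-at : (f : A → ℕ) → ∀ a → f a ≤ maximum (f ∘ at)
  ≤-maximum-at f a =
    subst (λ d → f d ≤ maximum (f ∘ at)) (at-index a) (≤-maximum (f ∘ at) (Inverse.to index a))

-- Used to replace bare incidence by an inductive view of it, on which edge maps are defined by
-- pattern matching.
PartialInjection-⊆ : {A B : Set} {P P′ : A → Set} {Q : B → Set} → (∀ a → P a → P′ a) →
                     PartialInjection P′ Q → PartialInjection P Q
PartialInjection-⊆ P⊆P′ φ = record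
  { to        = λ a p → to a (P⊆P′ a p)
  ; to-Q      = λ a p → to-Q a (P⊆P′ a p)
  ; injective = λ {a} {a′} p p′ → injective (P⊆P′ a p) (P⊆P′ a′ p′)
  }
  where open PartialInjection φ

-- Edges at the copy vertices of an edge corona

module CoronaProperties (G : Graph) (H : Graph.Edge G → Graph) where
  open EdgeCorona G H
  open Graph corona using (_∈ᵉ_; _∈ᵉ?_; edges)
  private
    module G = Graph G
    module H e = Graph (H e)

  data CopyIncident (e : G.Edge) (v : H.Vertex e) : CEdge → Set where
    along : ∀ d → H._∈ᵉ_ e v d → CopyIncident e v (copyEdge e d)
    join  : ∀ b → CopyIncident e v (joinEdge e v b)

  copyIncident : ∀ {e v} a → copy e v ∈ᵉ a → CopyIncident e v a
  copyIncident (baseEdge _)     (inj₁ ())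
  copyIncident (baseEdge _)     (inj₂ ())
  copyIncident (copyEdge _ d)   (inj₁ refl) = along d (inj₁ refl)
  copyIncident (copyEdge _ d)   (inj₂ refl) = along d (inj₂ refl)
  copyIncident (joinEdge _ _ b) (inj₁ ())
  copyIncident (joinEdge _ _ b) (inj₂ refl) = join b

  copyIncident⁻¹ : ∀ {e v} a → CopyIncident e v a → copy e v ∈ᵉ a
  copyIncident⁻¹ _ (along d (inj₁ refl)) = inj₁ refl
  copyIncident⁻¹ _ (along d (inj₂ refl)) = inj₂ refl
  copyIncident⁻¹ _ (join b)              = inj₂ refl

  join-injective : ∀ {e u v b b′} → _≡_ {A = CEdge} (joinEdge e u b) (joinEdge e v b′) → u ≡ v
  join-injective refl = refl

  copyEdge-injective : ∀ {e d d′} → _≡_ {A = CEdge} (copyEdge e d) (copyEdge e d′) → d ≡ d′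
  copyEdge-injective refl = refl

  module _ (e : G.Edge) (v : H.Vertex e) (b : Bool) where

    opposite-end : ∀ d → H._∈ᵉ_ e v d → H.Vertex e
    opposite-end d (inj₁ _) = proj₂ (H.ends e d)
    opposite-end d (inj₂ _) = proj₁ (H.ends e d)

    opposite-≢ : ∀ d i → opposite-end d i ≢ v
    opposite-≢ d (inj₁ v≡) eq = H.loopless e d (sym (trans eq v≡))
    opposite-≢ d (inj₂ v≡) eq = H.loopless e d (trans eq v≡)

    -- In a simple graph a neighbour of `v` determines the edge to it; the four cases are the stored
    -- orientations of the two edges.
    opposite-injective : ∀ d d′ i i′ → opposite-end d i ≡ opposite-end d′ i′ → d ≡ d′
    opposite-injective d d′ (inj₁ p) (inj₁ p′) eq =
      H.noParallel e d d′ (inj₁ (cong₂ _,_ (trans (sym p) p′) eq))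
    opposite-injective d d′ (inj₁ p) (inj₂ p′) eq =
      H.noParallel e d d′ (inj₂ (cong₂ _,_ (trans (sym p) p′) eq))
    opposite-injective d d′ (inj₂ p) (inj₁ p′) eq =
      H.noParallel e d d′ (inj₂ (cong₂ _,_ eq (trans (sym p) p′)))
    opposite-injective d d′ (inj₂ p) (inj₂ p′) eq =
      H.noParallel e d d′ (inj₁ (cong₂ _,_ eq (trans (sym p) p′)))

    swing : Bool → Bool → CEdge
    swing false false = joinEdge e v false
    swing true  true  = joinEdge e v true
    swing _     _     = baseEdge e

    -- Maps the edges at `v` to edges at the end of `e` selected by `b`: an edge from `v` to a
    -- neighbour becomes the join of that neighbour, the join of `v` to this end stays, and its join
    -- to the other end becomes `e` itself.
    towards : ∀ a → CopyIncident e v a → CEdge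
    towards _ (along d i) = joinEdge e (opposite-end d i) b
    towards _ (join b′)   = swing b b′

    towards-∈ : ∀ a i → base (endOf e b) ∈ᵉ towards a i
    towards-∈ _ (along d i) = inj₁ refl
    towards-∈ _ (join b′)   = swing-∈ b b′
      where
      swing-∈ : ∀ b b′ → base (endOf e b) ∈ᵉ swing b b′
      swing-∈ false false = inj₁ refl
      swing-∈ false true  = inj₁ refl
      swing-∈ true  false = inj₂ refl
      swing-∈ true  true  = inj₁ refl

    along≢swing : ∀ {u} b b′ → u ≢ v → joinEdge e u b ≢ swing b b′
    along≢swing false false u≢v eq = u≢v (join-injective eq)
    along≢swing true  true  u≢v eq = u≢v (join-injective eq)
    along≢swing false true  u≢v ()
    along≢swing true  false u≢v ()

    swing-injective : ∀ b b₁ b₂ → swing b b₁ ≡ swing b b₂ → b₁ ≡ b₂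
    swing-injective false false false _ = refl
    swing-injective false true  true  _ = refl
    swing-injective true  false false _ = refl
    swing-injective true  true  true  _ = refl
    swing-injective false false true  ()
    swing-injective false true  false ()
    swing-injective true  false true  ()
    swing-injective true  true  false ()

    towards-injective : ∀ {a a′} i i′ → towards a i ≡ towards a′ i′ → a ≡ a′
    towards-injective (along d i) (along d′ i′) eq =
      cong (λ d → copyEdge e d) (opposite-injective d d′ i i′ (join-injective eq))
    towards-injective (along d i) (join b′) eq = contradiction eq (along≢swing b b′ (opposite-≢ d i))
    towards-injective (join b′) (along d i) eq = contradiction (sym eq) (along≢swing b b′ (opposite-≢ d i))
    towards-injective (join b₁) (join b₂)   eq = cong (λ b′ → joinEdge e v b′) (swing-injective b b₁ b₂ eq)

    copy↪end : PartialInjection (CopyIncident e v) (base (endOf e b) ∈ᵉ_)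
    copy↪end = record { to = towards ; to-Q = towards-∈ ; injective = towards-injective }

  -- Each copy vertex has exactly two joins, one for each Boolean, so an injection of the edges
  -- inside the copies extends by matching the Booleans.
  copy-↪ : ∀ {e v e′ v′} → PartialInjection (H._∈ᵉ_ e v) (H._∈ᵉ_ e′ v′) →
           PartialInjection (CopyIncident e v) (copy e′ v′ ∈ᵉ_)
  copy-↪ {e} {v} {e′} {v′} φ = record { to = to′ ; to-Q = to-Q′ ; injective = injective′ }
    where
    open PartialInjection φ
    to′ : ∀ a → CopyIncident e v a → CEdge
    to′ _ (along d i) = copyEdge e′ (to d i)
    to′ _ (join b)    = joinEdge e′ v′ b

    to-Q′ : ∀ a i → copy e′ v′ ∈ᵉ to′ a i
    to-Q′ _ (along d i) = copyIncident⁻¹ _ (along (to d i) (to-Q d i))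
    to-Q′ _ (join b)    = inj₂ refl

    injective′ : ∀ {a a′} i i′ → to′ a i ≡ to′ a′ i′ → a ≡ a′
    injective′ (along d i) (along d′ i′) eq =
      cong (λ d → copyEdge e d) (injective i i′ (copyEdge-injective eq))
    injective′ (along _ _) (join _)      ()
    injective′ (join _)    (along _ _)   ()
    injective′ (join b)    (join b)      refl = refl

  -- The inequality is turned into an injection, extended over the joins and counted again; this
  -- replaces computing `d′` as the inner degree plus 2.
  d′-mono : ∀ {e v e′ v′} → H.deg e v ≤ H.deg e′ v′ → d′ (copy e v) ≤ d′ (copy e′ v′)
  d′-mono {e} {v} {e′} {v′} le = ∑-inject-≤ edges edges (copy e v ∈ᵉ?_) (copy e′ v′ ∈ᵉ?_)
    (PartialInjection-⊆ (copyIncident {e} {v})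
      (copy-↪ (∑-≤⇒inject (H.edges e) (H.edges e′) (H._∈ᵉ?_ e v) (H._∈ᵉ?_ e′ v′) le)))
    (λ _ _ → ≤-refl)

  δ′-≤ : ∀ e v → δ′ e ≤ d′ (copy e v)
  δ′-≤ e v = minimum-at-≤ (H.vertices e) (λ u → d′ (copy e u)) v

-- Blocks, classes and private edges of the spider corona

next : Fin 3 → Fin 3
next 0F = 1F
next 1F = 2F
next 2F = 0F

next-≢ : ∀ j → next j ≢ j
next-≢ 0F ()
next-≢ 1F ()
next-≢ 2F ()

-- The number 3j + k, filling the blocks 0 to 8; `legClass` is 2j + k, filling the classes 0 to 5.
-- Bounds and injectivity come from `combine`.
legBlock : Fin 3 → Fin 3 → ℕ
legBlock j k = toℕ (combine j k)

legClass : Fin 3 → Fin 2 → ℕ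
legClass j k = toℕ (combine j k)

legBlock-mono-< : ∀ j {k l} → toℕ k < toℕ l → legBlock j k < legBlock j l
legBlock-mono-< j {k} {l} k<l =
  subst₂ _<_ (sym (toℕ-combine j k)) (sym (toℕ-combine j l)) (+-monoʳ-< (3 * toℕ j) k<l)

-- Residue 1 modulo 3. The last two blocks fit the pattern: 9 is public, and 10, the block of the
-- edges at the centre, is private.
isPrivate : ℕ → Bool
isPrivate 0 = false
isPrivate 1 = true
isPrivate 2 = false
isPrivate (suc (suc (suc n))) = isPrivate n

isPrivate-legBlock : ∀ j k → isPrivate (legBlock j k) ≡ isPrivate (toℕ k)
isPrivate-legBlock 0F k = cong isPrivate (toℕ-combine {3} 0F k)
isPrivate-legBlock 1F k = cong isPrivate (toℕ-combine {3} 1F k)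
isPrivate-legBlock 2F k = cong isPrivate (toℕ-combine {3} 2F k)

-- Only even classes have private edges; the value at odd numbers is junk.
privateBlock : ℕ → ℕ
privateBlock 0             = 1
privateBlock 1             = 0
privateBlock (suc (suc n)) = 3 + privateBlock n

privateBlock-legClass : ∀ j → legBlock j 1F ≡ privateBlock (legClass j 0F)
privateBlock-legClass 0F = refl
privateBlock-legClass 1F = refl
privateBlock-legClass 2F = refl

-- Treats both spiders at once: p is `suc q`, and `single` allows at most one layer beyond the one
-- at the centre.
module Spider (q : ℕ) (H : Fin (suc q * 3) → Graph)
              (single : ∀ (s s′ : Fin q) → s ≡ s′)
              (nonempty : ∀ i → 1 ≤ Graph.order (H i))
              (outer≤inner : ∀ j j′ s → Graph.order (H (indexOf {suc q} (j , suc s))) ≤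
                                        Graph.order (H (indexOf {suc q} (j′ , zero)))) where
  open Γ (suc q) H public
  open Graph corona using (_∈ᵉ_; _∈ᵉ?_; edges) public

  HE : SpiderEdge (suc q) → Graph
  HE e = H (indexOf {suc q} e)

  open CoronaProperties (spider (suc q)) HE public

  -- In increasing order, for each leg j: the outer copy and its joins to the middle vertex
  -- (3j), its joins to the tip (3j+1, private), the outer leg edge (3j+2); then the inner copies
  -- and their joins to the middle vertices (9); then all edges at the centre (10, private).
  block : CEdge → ℕ
  block (baseEdge (j , zero))          = 10
  block (baseEdge (j , suc s))         = legBlock j 2F
  block (copyEdge (j , zero) _)        = 9
  block (copyEdge (j , suc s) _)       = legBlock j 0F
  block (joinEdge (j , zero) _ false)  = 10
  block (joinEdge (j , zero) _ true)   = 9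
  block (joinEdge (j , suc s) _ false) = legBlock j 0F
  block (joinEdge (j , suc s) _ true)  = legBlock j 1F

  class : CVertex → ℕ
  class (base (inj₁ tt))          = 7
  class (base (inj₂ (j , zero)))  = 6
  class (base (inj₂ (j , suc s))) = legClass j 1F
  class (copy (j , zero) _)       = 6
  class (copy (j , suc s) _)      = legClass j 0F

  open Criterion corona block isPrivate public

  centre : CVertex
  centre = base (inj₁ tt)

  hub : Fin 3 → CVertex
  hub j = base (inj₂ (j , zero))

  vertex-of : ∀ e → Graph.Vertex (HE e)
  vertex-of e = Finite.at (Graph.vertices (HE e)) (fromℕ< (nonempty (indexOf {suc q} e)))

  -- Under `towards` only the join to the chosen end is fixed. The two hypotheses say that the other
  -- join and the edges inside the copy move up; the other join gives strictness.
  copy⊏end : ∀ e v b → block (joinEdge e v (not b)) < block (baseEdge e) →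
             (∀ d u → block (copyEdge e d) < block (joinEdge e u b)) → copy e v ⊏ base (endOf e b)
  copy⊏end e v b j<b c<j = raises⇒⊏ record
    { φ      = PartialInjection-⊆ (copyIncident {e} {v}) (copy↪end e v b)
    ; raises = λ a i → lift a (copyIncident a i)
    ; strict = joinEdge e v (not b) , inj₂ refl , λ i → rise (copyIncident (joinEdge e v (not b)) i)
    }
    where
    swing-raises : ∀ b b′ → block (joinEdge e v (not b)) < block (baseEdge e) →
                   swing e v b b b′ ≡ joinEdge e v b′ ⊎ block (joinEdge e v b′) < block (swing e v b b b′)
    swing-raises false false _ = inj₁ refl
    swing-raises false true  l = inj₂ l
    swing-raises true  false l = inj₂ l
    swing-raises true  true  _ = inj₁ refl

    lift : ∀ a (i : CopyIncident e v a) → towards e v b a i ≡ a ⊎ block a < block (towards e v b a i)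
    lift _ (along d i) = inj₂ (c<j d _)
    lift _ (join b′)   = swing-raises b b′ j<b

    swing-not : ∀ b → swing e v b b (not b) ≡ baseEdge e
    swing-not false = refl
    swing-not true  = refl

    rise : (i : CopyIncident e v (joinEdge e v (not b))) →
           block (joinEdge e v (not b)) < block (towards e v b _ i)
    rise (join _) = subst (λ a → block (joinEdge e v (not b)) < block a) (sym (swing-not b)) j<b

  copy⊏centre : ∀ j v → copy (j , zero) v ⊏ centre
  copy⊏centre j v = copy⊏end (j , zero) v false (n<1+n 9) (λ _ _ → n<1+n 9)

  copy⊏outer : ∀ j s v → copy (j , suc s) v ⊏ base (inj₂ (j , suc s))
  copy⊏outer j s v = copy⊏end (j , suc s) v true
    (legBlock-mono-< j {0F} {2F} (s≤s z≤n)) (λ _ _ → legBlock-mono-< j {0F} {1F} (s≤s z≤n))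

  -- Incidence forces inject₁ s ≡ zero in the outer constructors; s is left free, as single
  -- already makes it unique.
  data HubIncident (j : Fin 3) : CEdge → Set where
    inner     : HubIncident j (baseEdge (j , zero))
    outer     : ∀ s → HubIncident j (baseEdge (j , suc s))
    innerJoin : ∀ v → HubIncident j (joinEdge (j , zero) v true)
    outerJoin : ∀ s v → HubIncident j (joinEdge (j , suc s) v false)

  hubIncident : ∀ {j} a → hub j ∈ᵉ a → HubIncident j a
  hubIncident (baseEdge (_ , zero))  (inj₁ ())
  hubIncident (baseEdge (_ , zero))  (inj₂ refl) = inner
  hubIncident (baseEdge (_ , suc s)) (inj₁ eq)
    with refl ← ,-injectiveˡ (inj₂-injective (inj₁-injective eq)) = outer s
  hubIncident (baseEdge (_ , suc s)) (inj₂ ())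
  hubIncident (copyEdge _ _)         (inj₁ ())
  hubIncident (copyEdge _ _)         (inj₂ ())
  hubIncident (joinEdge (_ , zero)  v false) (inj₁ ())
  hubIncident (joinEdge (_ , zero)  v true)  (inj₁ refl) = innerJoin v
  hubIncident (joinEdge (_ , suc s) v false) (inj₁ eq)
    with refl ← ,-injectiveˡ (inj₂-injective (inj₁-injective eq)) = outerJoin s v
  hubIncident (joinEdge (_ , suc s) v true)  (inj₁ ())
  hubIncident (joinEdge _ _ _)               (inj₂ ())

  module _ (j : Fin 3) where
    transfer : ∀ s → Σ[ f ∈ (Graph.Vertex (HE (j , suc s)) → Graph.Vertex (HE (next j , zero))) ]
                     Injective _≡_ _≡_ f
    transfer s = size-≤⇒inject (Graph.vertices (HE (j , suc s))) (Graph.vertices (HE (next j , zero)))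
                   (outer≤inner j (next j) s)

    -- Images of the inner edges stay in leg `j`, while the outer ones move to leg `next j`, so the
    -- two families cannot collide at the centre. The outer joins fit there because the outer copies
    -- are no larger than the inner ones.
    inwards : ∀ a → HubIncident j a → CEdge
    inwards _ inner           = baseEdge (j , zero)
    inwards _ (outer s)       = baseEdge (next j , zero)
    inwards _ (innerJoin v)   = joinEdge (j , zero) v false
    inwards _ (outerJoin s v) = joinEdge (next j , zero) (proj₁ (transfer s) v) false

    inwards-∈ : ∀ a i → centre ∈ᵉ inwards a i
    inwards-∈ _ inner           = inj₁ refl
    inwards-∈ _ (outer s)       = inj₁ refl
    inwards-∈ _ (innerJoin v)   = inj₁ refl
    inwards-∈ _ (outerJoin s v) = inj₁ refl

    leg : CEdge → Fin 3
    leg (baseEdge (j , _))     = j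
    leg (copyEdge (j , _) _)   = j
    leg (joinEdge (j , _) _ _) = j

    inwards-injective : ∀ {a a′} i i′ → inwards a i ≡ inwards a′ i′ → a ≡ a′
    inwards-injective inner           inner             _  = refl
    inwards-injective inner           (outer s)         eq = contradiction (sym (cong leg eq)) (next-≢ j)
    inwards-injective (outer s)       inner             eq = contradiction (cong leg eq) (next-≢ j)
    inwards-injective (outer s)       (outer s′)        _  =
      cong (λ s → baseEdge (j , suc s)) (single s s′)
    inwards-injective (innerJoin v)   (innerJoin v′)    eq =
      cong (λ v → joinEdge (j , zero) v true) (join-injective eq)
    inwards-injective (innerJoin v)   (outerJoin s′ v′) eq = contradiction (sym (cong leg eq)) (next-≢ j)
    inwards-injective (outerJoin s v) (innerJoin v′)    eq = contradiction (cong leg eq) (next-≢ j)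
    inwards-injective (outerJoin s v) (outerJoin s′ v′) eq with refl ← single s s′ =
      cong (λ v → joinEdge (j , suc s) v false) (proj₂ (transfer s) (join-injective eq))
    inwards-injective inner           (innerJoin _)     ()
    inwards-injective inner           (outerJoin _ _)   ()
    inwards-injective (outer _)       (innerJoin _)     ()
    inwards-injective (outer _)       (outerJoin _ _)   ()
    inwards-injective (innerJoin _)   inner             ()
    inwards-injective (innerJoin _)   (outer _)         ()
    inwards-injective (outerJoin _ _) inner             ()
    inwards-injective (outerJoin _ _) (outer _)         ()

  legBlock<10 : ∀ j k → legBlock j k < 10
  legBlock<10 j k = <-≤-trans (toℕ<n (combine j k)) (<⇒≤ (n<1+n 9))

  hub⊏centre : ∀ j → hub j ⊏ centre
  hub⊏centre j = raises⇒⊏ record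
    { φ      = PartialInjection-⊆ (hubIncident {j})
                 (record { to = inwards j ; to-Q = inwards-∈ j ; injective = inwards-injective j })
    ; raises = λ a i → lift a (hubIncident a i)
    ; strict = e₀ , inj₁ refl , λ i → rise (hubIncident e₀ i)
    }
    where
    -- The edge from the hub to the centre is fixed, so strictness is witnessed by an inner join,
    -- which exists because the copy is nonempty.
    e₀ = joinEdge (j , zero) (vertex-of (j , zero)) true

    lift : ∀ a (i : HubIncident j a) → inwards j a i ≡ a ⊎ block a < block (inwards j a i)
    lift _ inner           = inj₁ refl
    lift _ (outer s)       = inj₂ (legBlock<10 j 2F)
    lift _ (innerJoin v)   = inj₂ (n<1+n 9)
    lift _ (outerJoin s v) = inj₂ (legBlock<10 j 0F)

    rise : (i : HubIncident j e₀) → 9 < block (inwards j _ i)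
    rise (innerJoin _) = n<1+n 9

  private-copy : ∀ j v → Private (copy (j , zero) v) (joinEdge (j , zero) v false)
  private-copy j v = record
    { owned = refl ; private-block = refl ; only = λ a i → others a (copyIncident a i) }
    where
    others : ∀ a → CopyIncident (j , zero) v a → a ≢ joinEdge (j , zero) v false →
             isPrivate (block a) ≡ false
    others _ (along d _)  _  = refl
    others _ (join true)  _  = refl
    others _ (join false) a≢ = contradiction refl a≢

  private-outer-copy : ∀ j s v → Private (copy (j , suc s) v) (joinEdge (j , suc s) v true)
  private-outer-copy j s v = record
    { owned = refl ; private-block = isPrivate-legBlock j 1F ; only = λ a i → others a (copyIncident a i) }
    where
    others : ∀ a → CopyIncident (j , suc s) v a → a ≢ joinEdge (j , suc s) v true →
             isPrivate (block a) ≡ false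
    others _ (along d _)  _  = isPrivate-legBlock j 0F
    others _ (join true)  a≢ = contradiction refl a≢
    others _ (join false) _  = isPrivate-legBlock j 0F

  private-hub : ∀ j → Private (hub j) (baseEdge (j , zero))
  private-hub j = record
    { owned = refl ; private-block = refl ; only = λ a i → others a (hubIncident a i) }
    where
    others : ∀ a → HubIncident j a → a ≢ baseEdge (j , zero) → isPrivate (block a) ≡ false
    others _ inner           a≢ = contradiction refl a≢
    others _ (outer s)       _  = isPrivate-legBlock j 2F
    others _ (innerJoin v)   _  = refl
    others _ (outerJoin s v) _  = isPrivate-legBlock j 0F

  legClass<6 : ∀ j k → legClass j k < 6
  legClass<6 j k = toℕ<n (combine j k)

  private-or-only : ∀ u → (∃[ e ] Private u e × block e ≡ privateBlock (class u)) ⊎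
                          (∀ v → class u ≡ class v → u ≡ v)
  private-or-only (base (inj₁ tt))          = inj₂ λ
    { (base (inj₁ tt))          _  → refl
    ; (base (inj₂ (j , suc s))) eq → contradiction (sym eq) (<⇒≢ (m<n⇒m<1+n (legClass<6 j 1F)))
    ; (copy (j , suc s) v)      eq → contradiction (sym eq) (<⇒≢ (m<n⇒m<1+n (legClass<6 j 0F)))
    ; (base (inj₂ (_ , zero)))  ()
    ; (copy (_ , zero) _)       ()
    }
  private-or-only (base (inj₂ (j , zero)))  = inj₁ (baseEdge (j , zero) , private-hub j , refl)
  private-or-only (base (inj₂ (j , suc s))) = inj₂ λ
    { (base (inj₁ tt))            eq → contradiction eq (<⇒≢ (m<n⇒m<1+n (legClass<6 j 1F)))
    ; (base (inj₂ (_ , zero)))    eq → contradiction eq (<⇒≢ (legClass<6 j 1F))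
    -- The class number determines the leg, and `single` the position on it.
    ; (base (inj₂ (j′ , suc s′))) eq → cong₂ (λ j s → base (inj₂ (j , suc s)))
        (combine-injectiveˡ j 1F j′ 1F (toℕ-injective eq)) (single s s′)
    ; (copy (_ , zero) _)         eq → contradiction eq (<⇒≢ (legClass<6 j 1F))
    -- Tips have odd classes and outer copies even ones: the second component of `combine` differs.
    ; (copy (j′ , suc _) _)       eq →
        contradiction (combine-injectiveʳ {3} {2} j 1F j′ 0F (toℕ-injective eq)) λ ()
    }
  private-or-only (copy (j , zero) v)       = inj₁ (joinEdge (j , zero) v false , private-copy j v , refl)
  private-or-only (copy (j , suc s) v)      =
    inj₁ (joinEdge (j , suc s) v true , private-outer-copy j s v , privateBlock-legClass j)

-- The case p = 1, where only the classes 6 and 7 occur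

module OneLayer (H : Fin 3 → Graph) (two : ∀ i → 2 ≤ Graph.order (H i)) where
  open Spider 0 H (λ ()) (<⇒≤ ∘ two) (λ _ _ ())

  increasing : ∀ {u v} → class u < class v → u ⊏ v
  increasing {base (inj₂ (j , zero))} {base (inj₁ tt)} _ = hub⊏centre j
  increasing {copy (j , zero) v}      {base (inj₁ tt)} _ = copy⊏centre j v
  increasing {base (inj₁ tt)} {base (inj₁ tt)} lt = contradiction lt (<-irrefl refl)
  increasing {base (inj₁ tt)} {base (inj₂ (_ , zero))} lt = contradiction (<⇒≤ lt) (<-irrefl refl)
  increasing {base (inj₁ tt)} {copy (_ , zero) _} lt = contradiction (<⇒≤ lt) (<-irrefl refl)
  increasing {base (inj₂ (_ , zero))} {base (inj₂ (_ , zero))} lt = contradiction lt (<-irrefl refl)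
  increasing {base (inj₂ (_ , zero))} {copy (_ , zero) _} lt = contradiction lt (<-irrefl refl)
  increasing {copy (_ , zero) _} {base (inj₂ (_ , zero))} lt = contradiction lt (<-irrefl refl)
  increasing {copy (_ , zero) _} {copy (_ , zero) _} lt = contradiction lt (<-irrefl refl)

  corona-antimagic : Graph.Antimagic corona
  corona-antimagic = antimagic class privateBlock (λ {u} {v} → increasing {u} {v}) private-or-only

-- The case p = 2

-- Copies are numbered from the tips inwards: outer edges have indices 0 to 2 and inner ones 3 to 5.
-- All nine pairs are checked by evaluation.
indexOf-mono : ∀ j j′ → indexOf {2} (j , 1F) ≤ᶠ indexOf {2} (j′ , 0F)
indexOf-mono = from-yes (all? λ j → all? λ j′ → indexOf {2} (j , 1F) Fin.≤? indexOf {2} (j′ , 0F))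

module TwoLayers
  (H : Fin 6 → Graph)
  (two : ∀ i → 2 ≤ Graph.order (H i))
  (sorted : ∀ i j → i ≤ᶠ j → Graph.order (H i) ≤ Graph.order (H j))
  (Δ≤δ : ∀ (i : Fin 5) → Graph.Δ (H (inject₁ i)) ≤ Graph.δ (H (suc i)))
  (x₂≤ : Γ.d′ 2 H (Γ.x 2 H 2F) ≤ Γ.δ′H 2 H 1F)
  (y₂≤ : Γ.d′ 2 H (Γ.y 2 H 2F) ≤ Γ.δ′H 2 H 2F)
  (z₂≤ : Γ.d′ 2 H (Γ.z 2 H 2F) ≤ Γ.δ′H 2 H 3F)
  where
  single : ∀ (s s′ : Fin 1) → s ≡ s′
  single 0F 0F = refl

  outer≤inner : ∀ j j′ (s : Fin 1) → Graph.order (H (indexOf {2} (j , suc s))) ≤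
                                     Graph.order (H (indexOf {2} (j′ , zero)))
  outer≤inner j j′ 0F = sorted (indexOf {2} (j , 1F)) (indexOf {2} (j′ , 0F)) (indexOf-mono j j′)

  open Spider 1 H single (<⇒≤ ∘ two) outer≤inner

  tip : Fin 3 → CVertex
  tip j = base (inj₂ (j , 1F))

  data TipIncident (j : Fin 3) : CEdge → Set where
    last : TipIncident j (baseEdge (j , 1F))
    join : ∀ v → TipIncident j (joinEdge (j , 1F) v true)

  tipIncident : ∀ {j} a → tip j ∈ᵉ a → TipIncident j a
  tipIncident (baseEdge (_ , 0F)) (inj₁ ())
  tipIncident (baseEdge (_ , 1F)) (inj₁ ())
  tipIncident (baseEdge (_ , 1F)) (inj₂ refl) = last
  tipIncident (baseEdge (_ , 0F)) (inj₂ ())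
  tipIncident (copyEdge _ _) (inj₁ ())
  tipIncident (copyEdge _ _) (inj₂ ())
  tipIncident (joinEdge (_ , 0F) v false) (inj₁ ())
  tipIncident (joinEdge (_ , 1F) v false) (inj₁ ())
  tipIncident (joinEdge (_ , 0F) v true)  (inj₁ ())
  tipIncident (joinEdge (_ , 1F) v true)  (inj₁ refl) = join v
  tipIncident (joinEdge _ _ _) (inj₂ ())

  tip-block-≤ : ∀ {j a} → TipIncident j a → block a ≤ legBlock j 2F
  tip-block-≤     last     = ≤-refl
  tip-block-≤ {j} (join v) = <⇒≤ (legBlock-mono-< j {1F} {2F} (n<1+n 1))

  copy-block-≥ : ∀ {j v a} → CopyIncident (j , 1F) v a → legBlock j 0F ≤ block a
  copy-block-≥     (along _ _)  = ≤-refl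
  copy-block-≥     (join false) = ≤-refl
  copy-block-≥ {j} (join true)  = <⇒≤ (legBlock-mono-< j {0F} {1F} (s≤s z≤n))

  inner-copy-block-≥ : ∀ {j v a} → CopyIncident (j , 0F) v a → 9 ≤ block a
  inner-copy-block-≥ (along _ _)  = ≤-refl
  inner-copy-block-≥ (join false) = <⇒≤ (n<1+n 9)
  inner-copy-block-≥ (join true)  = ≤-refl

  -- The number `m` separates the blocks at the tip from those at the copy vertex, so only the
  -- degrees remain to be compared.
  tip⊏copy : ∀ j e v m → d′ (tip j) ≤ d′ (copy e v) → legBlock j 2F < m →
             (∀ {a} → CopyIncident e v a → m ≤ block a) → tip j ⊏ copy e v
  tip⊏copy j e v m d≤ l<m m≤ = deg-≤⇒⊏ d≤ (baseEdge (j , 1F) , inj₂ refl)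
    λ {a} {a′} i i′ → ≤-<-trans (tip-block-≤ (tipIncident a i)) (<-≤-trans l<m (m≤ (copyIncident a′ i′)))

  -- Here sizes replace a degree hypothesis: the leg edge at the tip goes to the edge from the hub
  -- to the centre, and the joins of `H₃` go to joins of an inner copy, which is at least as large.
  tip⊏hub : ∀ j → tip 2F ⊏ hub j
  tip⊏hub j = raises⇒⊏ record
    { φ      = PartialInjection-⊆ (tipIncident {2F})
                 (record { to = to ; to-Q = to-∈ ; injective = to-injective })
    ; raises = λ a i → inj₂ (lift a (tipIncident a i))
    ; strict = e₀ , inj₂ refl , λ i → lift e₀ (tipIncident e₀ i)
    }
    where
    e₀ = baseEdge (2F , 1F)

    transfers : Σ[ f ∈ (Graph.Vertex (HE (2F , 1F)) → Graph.Vertex (HE (j , 0F))) ]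
                Injective _≡_ _≡_ f
    transfers = size-≤⇒inject (Graph.vertices (HE (2F , 1F))) (Graph.vertices (HE (j , 0F)))
                  (outer≤inner 2F j 0F)

    to : ∀ a → TipIncident 2F a → CEdge
    to _ last     = baseEdge (j , 0F)
    to _ (join v) = joinEdge (j , 0F) (proj₁ transfers v) true

    to-∈ : ∀ a i → hub j ∈ᵉ to a i
    to-∈ _ last     = inj₂ refl
    to-∈ _ (join v) = inj₁ refl

    to-injective : ∀ {a a′} i i′ → to a i ≡ to a′ i′ → a ≡ a′
    to-injective last     last      _  = refl
    to-injective last     (join _)  ()
    to-injective (join _) last      ()
    to-injective (join v) (join v′) eq =
      cong (λ v → joinEdge (2F , 1F) v true) (proj₂ transfers (join-injective eq))

    lift : ∀ a i → block a < block (to a i)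
    lift _ last     = m<n⇒m<1+n (n<1+n 8)
    lift _ (join v) = m<n⇒m<1+n (n<1+n 7)

  deg-mono : ∀ (i : Fin 5) u v → Graph.deg (H (inject₁ i)) u ≤ Graph.deg (H (suc i)) v
  deg-mono i u v = ≤-trans (≤-maximum-at (Graph.vertices (H (inject₁ i))) (Graph.deg (H (inject₁ i))) u)
    (≤-trans (Δ≤δ i) (minimum-at-≤ (Graph.vertices (H (suc i))) (Graph.deg (H (suc i))) v))

  tip≤inner₀ : ∀ v → d′ (tip 2F) ≤ d′ (copy (0F , 0F) v)
  tip≤inner₀ v = ≤-trans z₂≤ (δ′-≤ (0F , 0F) v)

  -- The hypothesis on `z₂` speaks of `H₄` only. `Δ≤δ` carries it on to `H₅`, and then to `H₆`,
  -- through an arbitrary vertex `u` of the preceding copy.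
  tip≤inner₁ : ∀ v → d′ (tip 2F) ≤ d′ (copy (1F , 0F) v)
  tip≤inner₁ v = ≤-trans (tip≤inner₀ u) (d′-mono {0F , 0F} {u} {1F , 0F} {v} (deg-mono 3F u v))
    where u = vertex-of (0F , 0F)

  tip≤inner₂ : ∀ v → d′ (tip 2F) ≤ d′ (copy (2F , 0F) v)
  tip≤inner₂ v = ≤-trans (tip≤inner₁ u) (d′-mono {1F , 0F} {u} {2F , 0F} {v} (deg-mono 4F u v))
    where u = vertex-of (1F , 0F)

  tip≤inner : ∀ j v → d′ (tip 2F) ≤ d′ (copy (j , 0F) v)
  tip≤inner 0F = tip≤inner₀
  tip≤inner 1F = tip≤inner₁
  tip≤inner 2F = tip≤inner₂

  -- With the class number as an index, matching on members of two consecutive classes leaves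
  -- exactly the links of the chain.
  data InClass : CVertex → ℕ → Set where
    copy₀     : ∀ v → InClass (copy (0F , 1F) v) 0
    tip₀      : InClass (tip 0F) 1
    copy₁     : ∀ v → InClass (copy (1F , 1F) v) 2
    tip₁      : InClass (tip 1F) 3
    copy₂     : ∀ v → InClass (copy (2F , 1F) v) 4
    tip₂      : InClass (tip 2F) 5
    hubs      : ∀ j → InClass (hub j) 6
    innerCopy : ∀ j v → InClass (copy (j , 0F) v) 6
    top       : InClass centre 7

  inClass : ∀ v → InClass v (class v)
  inClass (base (inj₁ tt))         = top
  inClass (base (inj₂ (j , 0F)))   = hubs j
  inClass (base (inj₂ (0F , 1F)))  = tip₀
  inClass (base (inj₂ (1F , 1F)))  = tip₁
  inClass (base (inj₂ (2F , 1F)))  = tip₂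
  inClass (copy (j , 0F) v)        = innerCopy j v
  inClass (copy (0F , 1F) v)       = copy₀ v
  inClass (copy (1F , 1F) v)       = copy₁ v
  inClass (copy (2F , 1F) v)       = copy₂ v

  class-step : ∀ {u v k} → InClass u k → InClass v (suc k) → u ⊏ v
  class-step (copy₀ v)       tip₀            = copy⊏outer 0F 0F v
  class-step (copy₁ v)       tip₁            = copy⊏outer 1F 0F v
  class-step (copy₂ v)       tip₂            = copy⊏outer 2F 0F v
  class-step tip₀            (copy₁ v)       =
    tip⊏copy 0F (1F , 1F) v 3 (≤-trans x₂≤ (δ′-≤ (1F , 1F) v)) (n<1+n 2) copy-block-≥
  class-step tip₁            (copy₂ v)       =
    tip⊏copy 1F (2F , 1F) v 6 (≤-trans y₂≤ (δ′-≤ (2F , 1F) v)) (n<1+n 5) copy-block-≥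
  class-step tip₂            (hubs j)        = tip⊏hub j
  class-step tip₂            (innerCopy j v) =
    tip⊏copy 2F (j , 0F) v 9 (tip≤inner j v) (n<1+n 8) inner-copy-block-≥
  class-step (hubs j)        top             = hub⊏centre j
  class-step (innerCopy j v) top             = copy⊏centre j v

  class≤7 : ∀ v → class v ≤ 7
  class≤7 (base (inj₁ tt))         = ≤-refl
  class≤7 (base (inj₂ (_ , 0F)))   = <⇒≤ (n<1+n 6)
  class≤7 (base (inj₂ (j , 1F)))   = <⇒≤ (m<n⇒m<1+n (legClass<6 j 1F))
  class≤7 (copy (_ , 0F) _)        = <⇒≤ (n<1+n 6)
  class≤7 (copy (j , 1F) _)        = <⇒≤ (m<n⇒m<1+n (legClass<6 j 0F))

  class-dense : ∀ {u v} → suc (class u) < class v → ∃[ w ] class w ≡ suc (class u)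
  -- The centre has the top class 7, so nothing lies above it. In the other cases the next class is
  -- inhabited, by nonemptiness where it consists of copy vertices.
  class-dense {base (inj₁ tt)} {v} lt    = contradiction (class≤7 v) (<⇒≱ (<-trans (n<1+n 7) lt))
  class-dense {base (inj₂ (_ , 0F))}  _  = centre , refl
  class-dense {copy (_ , 0F) _}       _  = centre , refl
  class-dense {base (inj₂ (0F , 1F))} _  = copy (1F , 1F) (vertex-of (1F , 1F)) , refl
  class-dense {base (inj₂ (1F , 1F))} _  = copy (2F , 1F) (vertex-of (2F , 1F)) , refl
  class-dense {base (inj₂ (2F , 1F))} _  = hub 0F , refl
  class-dense {copy (0F , 1F) _}      _  = tip 0F , refl
  class-dense {copy (1F , 1F) _}      _  = tip 1F , refl
  class-dense {copy (2F , 1F) _}      _  = tip 2F , refl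

  corona-antimagic : Graph.Antimagic corona
  corona-antimagic = antimagic class privateBlock
    (λ {u} {v} → ⊏-chain class
      (λ {u} {v} eq → class-step (inClass u) (subst (InClass v) eq (inClass v)))
      (λ {u} {v} → class-dense {u} {v}) {u} {v})
    private-or-only

theorem2 :
  ((H : Fin 3 → Graph) →
   (∀ i → Graph.Connected (H i)) →
   (∀ i → 2 ≤ Graph.order (H i)) →
   (∀ i j → i ≤ᶠ j → Graph.order (H i) ≤ Graph.order (H j)) →
   Graph.Antimagic (Γ.corona 1 H))
  ×
  ((H : Fin 6 → Graph) →
   (∀ i → Graph.Connected (H i)) →
   (∀ i → 2 ≤ Graph.order (H i)) →
   (∀ i j → i ≤ᶠ j → Graph.order (H i) ≤ Graph.order (H j)) →
   (∀ (i : Fin 5) → Graph.Δ (H (inject₁ i)) ≤ Graph.δ (H (suc i))) →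
   Γ.d′ 2 H (Γ.x 2 H 2F) ≤ Γ.δ′H 2 H 1F →
   Γ.d′ 2 H (Γ.y 2 H 2F) ≤ Γ.δ′H 2 H 2F →
   Γ.d′ 2 H (Γ.z 2 H 2F) ≤ Γ.δ′H 2 H 3F →
   Graph.Antimagic (Γ.corona 2 H))
theorem2 =
  (λ H _ two _ → OneLayer.corona-antimagic H two) ,
  (λ H _ two sorted Δ≤δ x₂≤ y₂≤ z₂≤ → TwoLayers.corona-antimagic H two sorted Δ≤δ x₂≤ y₂≤ z₂≤)
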